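{- Let $s\ge 3$ and $\rho$ be integers such that $s-1\le \rho\le s^2-s-3$. There is no $[\rho s,s;3]$-bigraph whose order attains the Moore bound $M(\rho s,s;3)=(s^2-1)(\rho+1)$. Instead, the following improved Moore bound holds: every $[\rho s,s;3]$-bigraph has at most $$M^*(\rho s,s;3)=(s^2-2)(\rho+1)$$ vertices, this value corresponding to part sizes $N_1=s^2-2$ and $N_2=\rho(s^2-2)$.
   Context: Graphs are finite and simple. An $[r,s;d]$-bigraph is a bipartite graph $G=(V,E)$ with stable sets (parts) $V=V_1\cup V_2$, in which every vertex of $V_1$ has degree $r$, every vertex of $V_2$ has degree $s$, and the diameter is $d$. Write $N_i=|V_i|$ for $i=1,2$; the order of $G$ is $N_1+N_2$. For $r\ge s$, the Moore bound for diameter $3$ is $$M(r,s;3)=\left\lfloor \frac{1+s(r-1)}{\rho'}\right\rfloor(\rho'+\sigma'),\qquad \rho'=\frac{r}{\gcd(r,s)},\quad \sigma'=\frac{s}{\gcd(r,s)},$$ which is an upper bound on the order of any $[r,s;3]$-bigraph. For $r=\rho s$ with $\rho\ge s-1$ it equals $(s^2-1)(\rho+1)$, corresponding to $N_1=s^2-1$, $N_2=\rho(s^2-1)$. The improved bound is an upper bound; no claim is made that it is attained. -}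

module Defs where

open import Level using (0ℓ) renaming (suc to lsuc)
open import Data.Fin using (Fin)
open import Data.Fin.Subset using (Subset; _∈_; _∪_; _∩_; ⊤; ⊥; ∣_∣)
open import Data.Nat using (ℕ; zero; suc; _+_; _*_; _∸_; _≤_; NonZero; ≢-nonZero)
open import Data.Nat.DivMod using (_/_)
open import Data.Nat.GCD using (gcd; gcd[m,n]≢0; m/gcd[m,n]≢0)
open import Data.Product using (_×_; ∃-syntax)
open import Data.Sum using (inj₁)
open import Data.Vec using (tabulate)
open import Relation.Binary using (Rel; Symmetric; Irreflexive; Decidable)
open import Relation.Binary.PropositionalEquality using (_≡_)
open import Relation.Nullary using (¬_; does)

-- Decidability of adjacency is part of the data of a finite graph: it is what
-- makes the neighbourhood of a vertex a finite set with a cardinality.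
record Graph (n : ℕ) : Set (lsuc 0ℓ) where
  infix 4 _~_ _~?_
  field
    _~_      : Rel (Fin n) 0ℓ
    ~-sym    : Symmetric _~_
    ~-irrefl : Irreflexive _≡_ _~_
    _~?_     : Decidable _~_

  neighbours : Fin n → Subset n
  neighbours v = tabulate λ w → does (v ~? w)

  degree : Fin n → ℕ
  degree v = ∣ neighbours v ∣

  Stable : Subset n → Set
  Stable p = ∀ {u v} → u ∈ p → v ∈ p → ¬ (u ~ v)

  data Walk : ℕ → Fin n → Fin n → Set where
    []  : ∀ {u} → Walk 0 u u
    _∷_ : ∀ {k u v w} → u ~ v → Walk k v w → Walk (suc k) u w

  IsDistance : Fin n → Fin n → ℕ → Set
  IsDistance u v k = Walk k u v × (∀ {m} → Walk m u v → k ≤ m)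

  -- The diameter is the maximum distance; in particular all distances are
  -- finite, i.e. the graph is connected, and there is at least one vertex.
  HasDiameter : ℕ → Set
  HasDiameter d = (∀ u v → ∃[ k ] IsDistance u v k × k ≤ d)
                × (∃[ u ] ∃[ v ] IsDistance u v d)

record [_,_⨾_]-Bigraph (r s d : ℕ) : Set (lsuc 0ℓ) where
  field
    order : ℕ
    graph : Graph order

  open Graph graph public

  field
    V₁ V₂       : Subset order
    cover       : V₁ ∪ V₂ ≡ ⊤
    disjoint    : V₁ ∩ V₂ ≡ ⊥
    V₁-stable   : Stable V₁
    V₂-stable   : Stable V₂
    V₁-degree   : ∀ {v} → v ∈ V₁ → degree v ≡ r
    V₂-degree   : ∀ {v} → v ∈ V₂ → degree v ≡ s
    hasDiameter : HasDiameter d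

  N₁ N₂ : ℕ
  N₁ = ∣ V₁ ∣
  N₂ = ∣ V₂ ∣

-- The Moore bound M(r,s;3) for r ≥ s; _/_ on ℕ supplies the floor. The formula
-- requires r ≥ 1 (otherwise ρ′ = 0), so the value at r = 0 is a dummy.
M[_,_⨾3] : ℕ → ℕ → ℕ
M[ zero      , s ⨾3] = 0
M[ r@(suc _) , s ⨾3] = ((1 + s * (r ∸ 1)) / ρ′) * (ρ′ + σ′)
  where
  instance
    gcd-nonZero : NonZero (gcd r s)
    gcd-nonZero = ≢-nonZero (gcd[m,n]≢0 r s (inj₁ λ ()))

  ρ′ σ′ : ℕ
  ρ′ = r / gcd r s
  σ′ = s / gcd r s

  instance
    ρ′-nonZero : NonZero ρ′
    ρ′-nonZero = ≢-nonZero (m/gcd[m,n]≢0 r s)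

-- Regard V₂ as a family of blocks on the points V₁. Since parity rules out
-- odd distances inside a part, diameter 3 makes any two blocks meet, so the
-- intersection sizes I(B,C) satisfy (I − 1)(I − s) ≤ 0. The numbers λ(x,y) of
-- blocks through two points satisfy (λ − ρ)² ≥ 0, with value ρ²(s − 1)² for
-- x = y. As Σ I² = Σ λ², summing both over all pairs gives N₁ ≤ s² − s + 1, which
-- is at most s² − 2 as s ≥ 3.
module Submission where

open import Defs
import Algebra.Properties.Semiring.Sum as SemiringSum
open import Data.Bool using (Bool; true; false; _∧_)
open import Data.Bool.Properties using (∧-zeroʳ)
open import Data.Fin as Fin using (Fin)
open import Data.Fin.Properties using (any?)
open import Data.Fin.Subset using (Subset; _∈_; _∪_; _∩_; ⊤; ⊥; ∣_∣)
open import Data.Fin.Subset.Properties using (∈⊤; ∉⊥; x∈p∪q⁻; x∈p∩q⁺)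
open import Data.Nat using (ℕ; zero; suc; _+_; _*_; _∸_; _^_; _≤_; _<_; z≤n; s≤s; NonZero; >-nonZero)
open import Data.Nat.Divisibility using (n∣m*n; ∣-antisym; ∣-refl)
open import Data.Nat.DivMod using (_/_; /-congˡ; /-congʳ; +-distrib-/-∣ʳ; m<n⇒m/n≡0; m*n/n≡m; n/n≡1)
open import Data.Nat.GCD using (gcd; gcd[m,n]∣n; gcd-greatest)
open import Data.Nat.Properties
open import Data.Nat.Tactic.RingSolver using (solve-∀)
open import Data.Product using (_×_; _,_; proj₁; proj₂; ∃-syntax; Σ-syntax)
open import Data.Sum using (_⊎_; inj₁; inj₂)
open import Data.Vec using ([]; _∷_; lookup)
open import Data.Vec.Properties using (∷-injective; []=⇒lookup; lookup⇒[]=; lookup∘tabulate)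
open import Function using (_∘_; flip)
open import Function.Bundles using (_⇔_; mk⇔)
open import Relation.Binary.PropositionalEquality
open import Relation.Nullary using (¬_; does; yes; no; contradiction)
open import Relation.Nullary.Decidable using (dec-true; dec-false)
open [_,_⨾_]-Bigraph using (order; N₁; N₂)

open SemiringSum +-*-semiring
  using (sum; sum-syntax; sum-cong-≗; sum-replicate-zero; ∑-distrib-+; ∑-comm; *-distribˡ-sum; *-distribʳ-sum)

private
  variable
    k l m n : ℕ

-- Monotonicity and rearrangement of finite sums.

sum-mono : {f g : Fin n → ℕ} → (∀ i → f i ≤ g i) → sum f ≤ sum g
sum-mono {zero}  f≤g = z≤n
sum-mono {suc n} f≤g = +-mono-≤ (f≤g Fin.zero) (sum-mono (f≤g ∘ Fin.suc))

-- Slack at a single index survives summation. It serves to keep the exact diagonal value of the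
-- square in a sum whose other terms are only bounded.
sum-mono-gain : {f g : Fin n → ℕ} {c : ℕ} (i : Fin n) →
                f i + c ≤ g i → (∀ j → j ≢ i → f j ≤ g j) → sum f + c ≤ sum g
sum-mono-gain {suc n} {f} {g} {c} Fin.zero gain f≤g = begin
  f₀ + f₊ + c    ≡⟨ shuffle f₀ f₊ c ⟩
  (f₀ + c) + f₊  ≤⟨ +-mono-≤ gain (sum-mono λ j → f≤g (Fin.suc j) λ ()) ⟩
  sum g          ∎
  where
  open ≤-Reasoning
  f₀ = f Fin.zero
  f₊ = sum (f ∘ Fin.suc)
  shuffle : ∀ a b c → a + b + c ≡ (a + c) + b
  shuffle = solve-∀
sum-mono-gain {suc n} {f} {g} {c} (Fin.suc i) gain f≤g = begin
  f₀ + f₊ + c    ≡⟨ +-assoc f₀ f₊ c ⟩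
  f₀ + (f₊ + c)  ≤⟨ +-mono-≤ (f≤g Fin.zero λ ())
                      (sum-mono-gain i gain λ j j≢i → f≤g (Fin.suc j) λ { refl → j≢i refl }) ⟩
  sum g          ∎
  where
  open ≤-Reasoning
  f₀ = f Fin.zero
  f₊ = sum (f ∘ Fin.suc)

term≤sum : (f : Fin n → ℕ) (i : Fin n) → f i ≤ sum f
term≤sum f Fin.zero    = m≤m+n _ _
term≤sum f (Fin.suc i) = ≤-trans (term≤sum (f ∘ Fin.suc) i) (m≤n+m _ _)

sum*sum : (f : Fin m → ℕ) (g : Fin n → ℕ) → sum f * sum g ≡ ∑[ i < m ] ∑[ j < n ] (f i * g j)
sum*sum f g = trans (*-distribʳ-sum (sum g) f) (sum-cong-≗ λ i → *-distribˡ-sum (f i) g)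

-- Two exchanges of adjacent sums bring the innermost index outermost, which regroups a sum over
-- pairs of points by blocks.
∑-rotate : (f : Fin k → Fin l → Fin m → ℕ) →
           ∑[ x < k ] ∑[ y < l ] ∑[ z < m ] f x y z ≡ ∑[ z < m ] ∑[ x < k ] ∑[ y < l ] f x y z
∑-rotate f = trans (sum-cong-≗ λ x → ∑-comm (f x)) (∑-comm λ x z → sum (λ y → f x y z))

-- Gram matrices `a aᵀ`: for a 0/1 incidence matrix they count common blocks, and for its transpose
-- common points.

gram : (Fin k → Fin l → ℕ) → Fin k → Fin k → ℕ
gram {l = l} a x y = ∑[ B < l ] (a x B * a y B)

sum-gram : (a : Fin k → Fin l → ℕ) →
           ∑[ x < k ] ∑[ y < k ] gram a x y ≡ ∑[ B < l ] (sum (flip a B) * sum (flip a B))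
sum-gram a = trans (∑-rotate λ x y B → a x B * a y B)
                   (sum-cong-≗ λ B → sym (sum*sum (flip a B) (flip a B)))

-- tr ((a aᵀ)²) = tr ((aᵀ a)²).
sum-gram² : (a : Fin k → Fin l → ℕ) →
            ∑[ x < k ] ∑[ y < k ] (gram a x y * gram a x y)
          ≡ ∑[ B < l ] ∑[ C < l ] (gram (flip a) B C * gram (flip a) B C)
sum-gram² {k} {l} a = begin
  ∑[ x < k ] ∑[ y < k ] (gram a x y * gram a x y)
    ≡⟨ sum-cong-≗ (λ x → sum-cong-≗ λ y → sum*sum (λ B → a x B * a y B) (λ C → a x C * a y C)) ⟩
  ∑[ x < k ] ∑[ y < k ] ∑[ B < l ] ∑[ C < l ] (a x B * a y B * (a x C * a y C))
    ≡⟨ ∑-rotate (λ x y B → sum λ C → a x B * a y B * (a x C * a y C)) ⟩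
  ∑[ B < l ] ∑[ x < k ] ∑[ y < k ] ∑[ C < l ] (a x B * a y B * (a x C * a y C))
    ≡⟨ sum-cong-≗ (λ B → ∑-rotate λ x y C → a x B * a y B * (a x C * a y C)) ⟩
  ∑[ B < l ] ∑[ C < l ] ∑[ x < k ] ∑[ y < k ] (a x B * a y B * (a x C * a y C))
    ≡⟨ sum-cong-≗ (λ B → sum-cong-≗ λ C → sum-cong-≗ λ x → sum-cong-≗ λ y →
         interchange (a x B) (a y B) (a x C) (a y C)) ⟩
  ∑[ B < l ] ∑[ C < l ] ∑[ x < k ] ∑[ y < k ] (a x B * a x C * (a y B * a y C))
    ≡⟨ sum-cong-≗ (λ B → sum-cong-≗ λ C → sym (sum*sum (λ x → a x B * a x C) (λ y → a y B * a y C))) ⟩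
  ∑[ B < l ] ∑[ C < l ] (gram (flip a) B C * gram (flip a) B C) ∎
  where
  open ≡-Reasoning
  interchange : ∀ p q r s → p * q * (r * s) ≡ p * r * (q * s)
  interchange = solve-∀

-- Replacing the second factor of each product by 1 leaves the row sum of the first.
gram-bound : (a : Fin k → Fin l → ℕ) → (∀ x B → a x B ≤ 1) → ∀ x y → gram a x y ≤ sum (a x)
gram-bound a a≤1 x y = sum-mono λ B → ≤-trans (*-monoʳ-≤ (a x B) (a≤1 y B)) (≤-reflexive (*-identityʳ _))

-- Quadratic inequalities without subtraction.

2mn≤m²+n² : ∀ m n → 2 * m * n ≤ m * m + n * n
2mn≤m²+n² m n with ≤-total m n
-- With `d` the difference of the two numbers, the slack is `d * d`; ordering them first avoids
-- truncated subtraction.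
... | inj₁ m≤n with d , refl ← m≤n⇒∃[o]m+o≡n m≤n =
  ≤-trans (m≤m+n _ (d * d)) (≤-reflexive (expand m d))
  where
  expand : ∀ m d → 2 * m * (m + d) + d * d ≡ m * m + (m + d) * (m + d)
  expand = solve-∀
... | inj₂ n≤m with d , refl ← m≤n⇒∃[o]m+o≡n n≤m =
  ≤-trans (m≤m+n _ (d * d)) (≤-reflexive (expand n d))
  where
  expand : ∀ n d → 2 * (n + d) * n + d * d ≡ (n + d) * (n + d) + n * n
  expand = solve-∀

-- (i − 1)(i − s) ≤ 0 on [1, s].
i²+s≤[1+s]i : ∀ {i s} → 1 ≤ i → i ≤ s → i * i + s ≤ suc s * i
i²+s≤[1+s]i {suc i} 1≤i i≤s with d , refl ← m≤n⇒∃[o]m+o≡n i≤s =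
  ≤-trans (m≤m+n _ (i * d)) (≤-reflexive (expand i d))
  where
  expand : ∀ i d → suc i * suc i + (suc i + d) + i * d ≡ suc (suc i + d) * suc i
  expand = solve-∀

-- Indicators and the double count in a regular intersecting family.

𝟙 : Bool → ℕ
𝟙 false = 0
𝟙 true  = 1

𝟙≤1 : ∀ b → 𝟙 b ≤ 1
𝟙≤1 false = z≤n
𝟙≤1 true  = ≤-refl

𝟙-idem : ∀ b → 𝟙 b * 𝟙 b ≡ 𝟙 b
𝟙-idem false = refl
𝟙-idem true  = refl

-- Points and blocks are marked by `P` and `Q` inside larger index types, so that both types can
-- later be the whole vertex set of a graph. Unmarked rows and columns have sum zero. The block size
-- is `suc t`, so it is positive by its form and `t` stands for s - 1.
module RegularIntersectingFamily
  (inc : Fin k → Fin l → Bool) (P : Fin k → Bool) (Q : Fin l → Bool) (ρ t : ℕ)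
  (row : ∀ x → ∑[ B < l ] 𝟙 (inc x B) ≡ 𝟙 (P x) * (ρ * suc t))
  (col : ∀ B → ∑[ x < k ] 𝟙 (inc x B) ≡ 𝟙 (Q B) * suc t)
  (meet : ∀ {B C} → Q B ≡ true → Q C ≡ true → ∃[ x ] inc x B ≡ true × inc x C ≡ true)
  where

  private
    s : ℕ
    s = suc t

    a : Fin k → Fin l → ℕ
    a x B = 𝟙 (inc x B)

    b : Fin l → Fin k → ℕ
    b = flip a

    λ₂ : Fin k → Fin k → ℕ
    λ₂ = gram a

    I : Fin l → Fin l → ℕ
    I = gram b

  points blocks : ℕ
  points = ∑[ x < k ] 𝟙 (P x)
  blocks = ∑[ B < l ] 𝟙 (Q B)

  -- Incident pairs are counted once by blocks and once by points; the positive block size `s` then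
  -- cancels.
  blocks≡ρ*points : blocks ≡ ρ * points
  blocks≡ρ*points = *-cancelʳ-≡ blocks (ρ * points) s (begin
    blocks * s                       ≡⟨ *-distribʳ-sum s (𝟙 ∘ Q) ⟩
    ∑[ B < l ] (𝟙 (Q B) * s)         ≡⟨ sum-cong-≗ col ⟨
    ∑[ B < l ] ∑[ x < k ] a x B      ≡⟨ ∑-comm (flip a) ⟩
    ∑[ x < k ] ∑[ B < l ] a x B      ≡⟨ sum-cong-≗ row ⟩
    ∑[ x < k ] (𝟙 (P x) * (ρ * s))   ≡⟨ *-distribʳ-sum (ρ * s) (𝟙 ∘ P) ⟨
    points * (ρ * s)                 ≡⟨ shuffle points ρ s ⟩
    ρ * points * s                   ∎)
    where
    open ≡-Reasoning
    shuffle : ∀ n ρ s → n * (ρ * s) ≡ ρ * n * s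
    shuffle = solve-∀

  private
    scaled-square : ∀ b c → 𝟙 b * c * (𝟙 b * c) ≡ 𝟙 b * (c * c)
    scaled-square false c = refl
    scaled-square true  c = trans (cong₂ _*_ (+-identityʳ c) (+-identityʳ c)) (sym (+-identityʳ _))

    -- Each block contains `s * s` ordered pairs of points.
    sum-λ₂ : ∑[ x < k ] ∑[ y < k ] λ₂ x y ≡ blocks * (s * s)
    sum-λ₂ = begin
      ∑[ x < k ] ∑[ y < k ] λ₂ x y              ≡⟨ sum-gram a ⟩
      ∑[ B < l ] (sum (b B) * sum (b B))        ≡⟨ sum-cong-≗ (λ B → cong₂ _*_ (col B) (col B)) ⟩
      ∑[ B < l ] (𝟙 (Q B) * s * (𝟙 (Q B) * s))  ≡⟨ sum-cong-≗ (λ B → scaled-square (Q B) s) ⟩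
      ∑[ B < l ] (𝟙 (Q B) * (s * s))            ≡⟨ *-distribʳ-sum (s * s) (𝟙 ∘ Q) ⟨
      blocks * (s * s)                          ∎
      where open ≡-Reasoning

    -- Dually, each point lies in the square of `ρ * s` many ordered pairs of blocks.
    sum-I : ∑[ B < l ] ∑[ C < l ] I B C ≡ points * (ρ * s * (ρ * s))
    sum-I = begin
      ∑[ B < l ] ∑[ C < l ] I B C                           ≡⟨ sum-gram b ⟩
      ∑[ x < k ] (sum (a x) * sum (a x))                    ≡⟨ sum-cong-≗ (λ x → cong₂ _*_ (row x) (row x)) ⟩
      ∑[ x < k ] (𝟙 (P x) * (ρ * s) * (𝟙 (P x) * (ρ * s)))  ≡⟨ sum-cong-≗ (λ x → scaled-square (P x) (ρ * s)) ⟩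
      ∑[ x < k ] (𝟙 (P x) * (ρ * s * (ρ * s)))              ≡⟨ *-distribʳ-sum (ρ * s * (ρ * s)) (𝟙 ∘ P) ⟨
      points * (ρ * s * (ρ * s))                            ∎
      where open ≡-Reasoning

    λ₂-comm : ∀ x y → λ₂ x y ≡ λ₂ y x
    λ₂-comm x y = sum-cong-≗ λ B → *-comm (a x B) (a y B)

    -- Its use is off the marked set: when `P x` is false the right side is zero, so `λ₂ x y`
    -- vanishes.
    λ₂≤ : ∀ x y → λ₂ x y ≤ 𝟙 (P x) * (ρ * s)
    λ₂≤ x y = ≤-trans (gram-bound a (λ x B → 𝟙≤1 (inc x B)) x y) (≤-reflexive (row x))

    λ₂-diagonal : ∀ x → λ₂ x x ≡ 𝟙 (P x) * (ρ * s)
    λ₂-diagonal x = trans (sum-cong-≗ λ B → 𝟙-idem (inc x B)) (row x)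

    I-comm : ∀ B C → I B C ≡ I C B
    I-comm B C = sum-cong-≗ λ x → *-comm (a x B) (a x C)

    I≤ : ∀ B C → I B C ≤ 𝟙 (Q B) * s
    I≤ B C = ≤-trans (gram-bound b (λ B x → 𝟙≤1 (inc x B)) B C) (≤-reflexive (col B))

    -- For two points this is (λ - ρ)² ≥ 0, expanded. If either index is unmarked, the bound on
    -- `λ₂`, applied in both orders by symmetry, makes the left side zero.
    points-pairwise : ∀ x y → 2 * ρ * λ₂ x y ≤ λ₂ x y * λ₂ x y + 𝟙 (P x) * 𝟙 (P y) * (ρ * ρ)
    points-pairwise x y with P x | P y | λ₂≤ x y | subst (_≤ _) (λ₂-comm y x) (λ₂≤ y x)
    ... | true  | true  | _  | _  =
      ≤-trans (2mn≤m²+n² ρ (λ₂ x y))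
              (≤-reflexive (trans (+-comm (ρ * ρ) _) (cong (λ₂ x y * λ₂ x y +_) (sym (+-identityʳ _)))))
    ... | true  | false | _  | ≤0 rewrite n≤0⇒n≡0 ≤0 | *-zeroʳ (2 * ρ) = z≤n
    ... | false | _     | ≤0 | _  rewrite n≤0⇒n≡0 ≤0 | *-zeroʳ (2 * ρ) = z≤n

    -- At a point, λ = ρs turns (λ - ρ)² into exactly ρ²t², so here the inequality is an equality.
    points-diagonal : ∀ x → 2 * ρ * λ₂ x x + 𝟙 (P x) * (ρ * ρ * (t * t))
                          ≤ λ₂ x x * λ₂ x x + 𝟙 (P x) * 𝟙 (P x) * (ρ * ρ)
    points-diagonal x rewrite λ₂-diagonal x with P x
    ... | true  = ≤-reflexive (expand ρ t)
      where
      expand : ∀ ρ t → 2 * ρ * (1 * (ρ * suc t)) + 1 * (ρ * ρ * (t * t))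
                     ≡ 1 * (ρ * suc t) * (1 * (ρ * suc t)) + 1 * 1 * (ρ * ρ)
      expand = solve-∀
    ... | false rewrite *-zeroʳ (2 * ρ) = z≤n

    -- For two blocks, `meet` gives I ≥ 1 and the block size gives I ≤ s, hence (I - 1)(I - s) ≤ 0.
    -- For an unmarked index, I is zero.
    blocks-pairwise : ∀ B C → I B C * I B C + 𝟙 (Q B) * 𝟙 (Q C) * s ≤ suc s * I B C
    blocks-pairwise B C with Q B in QB | Q C in QC | I≤ B C | subst (_≤ _) (I-comm C B) (I≤ C B)
    ... | true  | true  | I≤s | _ =
      subst (λ z → I B C * I B C + z ≤ suc s * I B C) (sym (*-identityˡ s))
            (i²+s≤[1+s]i 1≤I (subst (I B C ≤_) (*-identityˡ s) I≤s))
      where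
      1≤I : 1 ≤ I B C
      1≤I with x , xB , xC ← meet QB QC =
        -- The term of the sum at a common point is already 1.
        subst (_≤ I B C) (cong₂ (λ u v → 𝟙 u * 𝟙 v) xB xC) (term≤sum (λ x → a x B * a x C) x)
    ... | true  | false | _  | ≤0 rewrite n≤0⇒n≡0 ≤0 = z≤n
    ... | false | _     | ≤0 | _  rewrite n≤0⇒n≡0 ≤0 = z≤n

    sum-scaled-pairs : ∀ {n} (R : Fin n → Bool) c →
      ∑[ i < n ] ∑[ j < n ] (𝟙 (R i) * 𝟙 (R j) * c) ≡ sum (𝟙 ∘ R) * sum (𝟙 ∘ R) * c
    sum-scaled-pairs {n} R c = begin
      ∑[ i < n ] ∑[ j < n ] (𝟙 (R i) * 𝟙 (R j) * c)   ≡⟨ sum-cong-≗ (λ i → *-distribʳ-sum c (λ j → 𝟙 (R i) * 𝟙 (R j))) ⟨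
      ∑[ i < n ] (∑[ j < n ] (𝟙 (R i) * 𝟙 (R j)) * c) ≡⟨ *-distribʳ-sum c (λ i → sum λ j → 𝟙 (R i) * 𝟙 (R j)) ⟨
      (∑[ i < n ] ∑[ j < n ] (𝟙 (R i) * 𝟙 (R j))) * c ≡⟨ cong (_* c) (sum*sum (𝟙 ∘ R) (𝟙 ∘ R)) ⟨
      sum (𝟙 ∘ R) * sum (𝟙 ∘ R) * c                   ∎
      where open ≡-Reasoning

    ∑∑-distrib-+ : ∀ {m n} (f g : Fin m → Fin n → ℕ) →
      ∑[ i < m ] ∑[ j < n ] (f i j + g i j) ≡ ∑[ i < m ] ∑[ j < n ] f i j + ∑[ i < m ] ∑[ j < n ] g i j
    ∑∑-distrib-+ f g = trans (sum-cong-≗ λ i → ∑-distrib-+ (f i) (g i)) (∑-distrib-+ (sum ∘ f) (sum ∘ g))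

    ∑∑-distribˡ-* : ∀ {m n} c (f : Fin m → Fin n → ℕ) →
      c * (∑[ i < m ] ∑[ j < n ] f i j) ≡ ∑[ i < m ] ∑[ j < n ] (c * f i j)
    ∑∑-distribˡ-* c f = trans (*-distribˡ-sum c (sum ∘ f)) (sum-cong-≗ λ i → *-distribˡ-sum c (f i))

    Σλ² : ℕ
    Σλ² = ∑[ x < k ] ∑[ y < k ] (λ₂ x y * λ₂ x y)

    -- The pairwise inequalities are summed over all `x` and `y`, and each row `x` gains its
    -- diagonal term.
    points-total : 2 * ρ * (blocks * (s * s)) + points * (ρ * ρ * (t * t)) ≤ Σλ² + points * points * (ρ * ρ)
    points-total = begin
      2 * ρ * (blocks * (s * s)) + points * d
        ≡⟨ cong₂ _+_ (trans (cong (2 * ρ *_) (sym sum-λ₂)) (*-distribˡ-sum (2 * ρ) (sum ∘ λ₂))) (*-distribʳ-sum d (𝟙 ∘ P)) ⟩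
      ∑[ x < k ] (2 * ρ * sum (λ₂ x)) + ∑[ x < k ] (𝟙 (P x) * d)
        ≡⟨ ∑-distrib-+ (λ x → 2 * ρ * sum (λ₂ x)) (λ x → 𝟙 (P x) * d) ⟨
      ∑[ x < k ] (2 * ρ * sum (λ₂ x) + 𝟙 (P x) * d)
        ≡⟨ sum-cong-≗ (λ x → cong (_+ 𝟙 (P x) * d) (*-distribˡ-sum (2 * ρ) (λ₂ x))) ⟩
      ∑[ x < k ] (∑[ y < k ] (2 * ρ * λ₂ x y) + 𝟙 (P x) * d)
        ≤⟨ sum-mono (λ x → sum-mono-gain x (points-diagonal x) (λ y _ → points-pairwise x y)) ⟩
      ∑[ x < k ] ∑[ y < k ] (λ₂ x y * λ₂ x y + 𝟙 (P x) * 𝟙 (P y) * (ρ * ρ))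
        ≡⟨ ∑∑-distrib-+ (λ x y → λ₂ x y * λ₂ x y) (λ x y → 𝟙 (P x) * 𝟙 (P y) * (ρ * ρ)) ⟩
      Σλ² + ∑[ x < k ] ∑[ y < k ] (𝟙 (P x) * 𝟙 (P y) * (ρ * ρ))
        ≡⟨ cong (Σλ² +_) (sum-scaled-pairs P (ρ * ρ)) ⟩
      Σλ² + points * points * (ρ * ρ) ∎
      where
      open ≤-Reasoning
      d = ρ * ρ * (t * t)

    -- The trace identity `sum-gram²` turns `Σλ²` into the sum of the I², so this bounds from above
    -- the quantity that `points-total` bounds from below.
    blocks-total : Σλ² + blocks * blocks * s ≤ suc s * (points * (ρ * s * (ρ * s)))
    blocks-total = begin
      Σλ² + blocks * blocks * s
        ≡⟨ cong₂ _+_ (sum-gram² a) (sym (sum-scaled-pairs Q s)) ⟩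
      ∑[ B < l ] ∑[ C < l ] (I B C * I B C) + ∑[ B < l ] ∑[ C < l ] (𝟙 (Q B) * 𝟙 (Q C) * s)
        ≡⟨ ∑∑-distrib-+ (λ B C → I B C * I B C) (λ B C → 𝟙 (Q B) * 𝟙 (Q C) * s) ⟨
      ∑[ B < l ] ∑[ C < l ] (I B C * I B C + 𝟙 (Q B) * 𝟙 (Q C) * s)
        ≤⟨ sum-mono (λ B → sum-mono (blocks-pairwise B)) ⟩
      ∑[ B < l ] ∑[ C < l ] (suc s * I B C)
        ≡⟨ ∑∑-distribˡ-* (suc s) I ⟨
      suc s * (∑[ B < l ] ∑[ C < l ] I B C)
        ≡⟨ cong (suc s *_) sum-I ⟩
      suc s * (points * (ρ * s * (ρ * s))) ∎
      where open ≤-Reasoning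

  -- Adding the two totals cancels `Σλ²`. With n points and ρn blocks, division by ρ²n leaves t(n +
  -- t) + e ≤ ts² + e; cancelling `e` and then `t` gives the claim, which is n ≤ s² - s + 1 because
  -- t = s - 1.
  points≤s²-s+1 : .{{NonZero ρ}} → .{{NonZero t}} → points + t ≤ s * s
  points≤s²-s+1 with points | blocks | blocks≡ρ*points | points-total | blocks-total
  -- Division by n needs a point; without one, the claim is t ≤ s².
  ... | zero      | _ | _    | _  | _  = ≤-trans (n≤1+n t) (m≤m*n s s)
  ... | n@(suc _) | _ | refl | pt | bt = *-cancelˡ-≤ t (+-cancelʳ-≤ e _ _ (*-cancelˡ-≤ (ρ * ρ * n) {{ρ²n≢0}} (begin
    ρ * ρ * n * (t * (n + t) + e)
      ≡⟨ lhs ρ t n ⟩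
    2 * ρ * (ρ * n * (s * s)) + n * (ρ * ρ * (t * t)) + ρ * n * (ρ * n) * s
      ≤⟨ +-cancelˡ-≤ Σλ² _ _ (begin
        Σλ² + (2 * ρ * (ρ * n * (s * s)) + n * (ρ * ρ * (t * t)) + ρ * n * (ρ * n) * s)
          ≡⟨ swap Σλ² (2 * ρ * (ρ * n * (s * s)) + n * (ρ * ρ * (t * t))) (ρ * n * (ρ * n) * s) ⟩
        2 * ρ * (ρ * n * (s * s)) + n * (ρ * ρ * (t * t)) + (Σλ² + ρ * n * (ρ * n) * s)
          ≤⟨ +-mono-≤ pt bt ⟩
        Σλ² + n * n * (ρ * ρ) + suc s * (n * (ρ * s * (ρ * s)))
          ≡⟨ +-assoc Σλ² _ _ ⟩
        Σλ² + (n * n * (ρ * ρ) + suc s * (n * (ρ * s * (ρ * s)))) ∎) ⟩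
    n * n * (ρ * ρ) + suc s * (n * (ρ * s * (ρ * s)))
      ≡⟨ rhs ρ t n ⟩
    ρ * ρ * n * (t * (s * s) + e) ∎)))
    where
    open ≤-Reasoning
    -- The part common to both sides after division by ρ²n.
    e = 2 * (s * s) + n
    ρ²n≢0 : NonZero (ρ * ρ * n)
    ρ²n≢0 = m*n≢0 (ρ * ρ) n {{m*n≢0 ρ ρ}}
    swap : ∀ a b c → a + (b + c) ≡ b + (a + c)
    swap = solve-∀
    lhs : ∀ ρ t n → ρ * ρ * n * (t * (n + t) + (2 * (suc t * suc t) + n))
                  ≡ 2 * ρ * (ρ * n * (suc t * suc t)) + n * (ρ * ρ * (t * t)) + ρ * n * (ρ * n) * suc t
    lhs = solve-∀
    rhs : ∀ ρ t n → n * n * (ρ * ρ) + suc (suc t) * (n * (ρ * suc t * (ρ * suc t)))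
                  ≡ ρ * ρ * n * (t * (suc t * suc t) + (2 * (suc t * suc t) + n))
    rhs = solve-∀

-- Cardinalities of subsets, and the incidence structure of a bigraph.

∣p∣≡∑ : (p : Subset n) → ∣ p ∣ ≡ ∑[ i < n ] 𝟙 (lookup p i)
∣p∣≡∑ []          = refl
∣p∣≡∑ (true  ∷ p) = cong suc (∣p∣≡∑ p)
∣p∣≡∑ (false ∷ p) = ∣p∣≡∑ p

∣p∣+∣q∣≡n : (p q : Subset n) → p ∪ q ≡ ⊤ → p ∩ q ≡ ⊥ → ∣ p ∣ + ∣ q ∣ ≡ n
∣p∣+∣q∣≡n []          []          _ _ = refl
∣p∣+∣q∣≡n (true  ∷ p) (false ∷ q) c d = cong suc (∣p∣+∣q∣≡n p q (proj₂ (∷-injective c)) (proj₂ (∷-injective d)))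
∣p∣+∣q∣≡n (false ∷ p) (true  ∷ q) c d =
  trans (+-suc ∣ p ∣ ∣ q ∣) (cong suc (∣p∣+∣q∣≡n p q (proj₂ (∷-injective c)) (proj₂ (∷-injective d))))

module BigraphBound {ρ t : ℕ} (G : [ ρ * suc t , suc t ⨾ 3 ]-Bigraph) where
  open [_,_⨾_]-Bigraph G hiding (order; N₁; N₂)

  private
    o : ℕ
    o = order G

    P Q : Fin o → Bool
    P = lookup V₁
    Q = lookup V₂

    -- Both arguments range over all vertices; the guard `P x` orients every edge from `V₁` to `V₂`,
    -- so that it is counted once.
    inc : Fin o → Fin o → Bool
    inc x B = P x ∧ does (x ~? B)

    part : ∀ v → v ∈ V₁ ⊎ v ∈ V₂
    part v = x∈p∪q⁻ V₁ V₂ (subst (v ∈_) (sym cover) ∈⊤)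

    exclusive : ∀ {v} → v ∈ V₁ → ¬ (v ∈ V₂)
    exclusive v∈V₁ v∈V₂ = ∉⊥ (subst (_ ∈_) disjoint (x∈p∩q⁺ (v∈V₁ , v∈V₂)))

    crossʳ : ∀ {u v} → u ∈ V₂ → u ~ v → v ∈ V₁
    crossʳ {v = v} u∈V₂ u~v with part v
    ... | inj₁ v∈V₁ = v∈V₁
    ... | inj₂ v∈V₂ = contradiction u~v (V₂-stable u∈V₂ v∈V₂)

    degree≡∑ : ∀ v → degree v ≡ ∑[ w < o ] 𝟙 (does (v ~? w))
    degree≡∑ v = trans (∣p∣≡∑ (neighbours v)) (sum-cong-≗ λ w → cong 𝟙 (lookup∘tabulate (does ∘ (v ~?_)) w))

    row : ∀ x → ∑[ B < o ] 𝟙 (inc x B) ≡ 𝟙 (P x) * (ρ * suc t)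
    row x with P x in Px
    ... | true  = trans (sym (degree≡∑ x)) (trans (V₁-degree (lookup⇒[]= x V₁ Px)) (sym (*-identityˡ _)))
    ... | false = sum-replicate-zero o

    -- Neighbours of a vertex of `V₂` lie in `V₁`, so the guard in `inc` holds at each of them.
    -- Column sums at blocks thereby become degrees.
    incident-to-V₂ : ∀ {B} → B ∈ V₂ → ∀ x → inc x B ≡ does (B ~? x)
    incident-to-V₂ {B} B∈V₂ x with B ~? x
    ... | yes B~x = cong₂ _∧_ ([]=⇒lookup (crossʳ B∈V₂ B~x)) (dec-true (x ~? B) (~-sym B~x))
    ... | no ¬B~x = trans (cong (P x ∧_) (dec-false (x ~? B) (¬B~x ∘ ~-sym))) (∧-zeroʳ (P x))

    incident-to-V₁ : ∀ {B} → B ∈ V₁ → ∀ x → inc x B ≡ false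
    incident-to-V₁ {B} B∈V₁ x with P x in Px
    ... | false = refl
    ... | true  = dec-false (x ~? B) (V₁-stable (lookup⇒[]= x V₁ Px) B∈V₁)

    col : ∀ B → ∑[ x < o ] 𝟙 (inc x B) ≡ 𝟙 (Q B) * suc t
    col B with part B
    ... | inj₁ B∈V₁ with Q B in QB
    ...   | true  = contradiction (lookup⇒[]= B V₂ QB) (exclusive B∈V₁)
    ...   | false = trans (sum-cong-≗ λ x → cong 𝟙 (incident-to-V₁ B∈V₁ x)) (sum-replicate-zero o)
    col B | inj₂ B∈V₂ rewrite []=⇒lookup B∈V₂ = begin
      ∑[ x < o ] 𝟙 (inc x B)          ≡⟨ sum-cong-≗ (λ x → cong 𝟙 (incident-to-V₂ B∈V₂ x)) ⟩
      ∑[ x < o ] 𝟙 (does (B ~? x))    ≡⟨ degree≡∑ B ⟨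
      degree B                        ≡⟨ V₂-degree B∈V₂ ⟩
      suc t                           ≡⟨ *-identityˡ (suc t) ⟨
      1 * suc t                       ∎
      where open ≡-Reasoning

    neighbour : ∀ {B} → B ∈ V₂ → ∃[ x ] B ~ x
    neighbour {B} B∈V₂ with any? (B ~?_)
    ... | yes ∃x = ∃x
    ... | no ∄x = contradiction (trans (sym (V₂-degree B∈V₂)) degree≡0) λ ()
      where
      degree≡0 : degree B ≡ 0
      degree≡0 = trans (degree≡∑ B)
        (trans (sum-cong-≗ λ x → cong 𝟙 (dec-false (B ~? x) λ B~x → ∄x (x , B~x))) (sum-replicate-zero o))

    -- By parity only lengths 0 and 2 occur: in the first case the blocks coincide and any neighbour
    -- serves, in the second the middle vertex does.
    common-neighbour : ∀ {k B C} → B ∈ V₂ → C ∈ V₂ → Walk k B C → k ≤ 3 → ∃[ x ] B ~ x × C ~ x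
    common-neighbour B∈ C∈ [] _ with x , B~x ← neighbour B∈ = x , B~x , B~x
    common-neighbour B∈ C∈ (B~C ∷ []) _ = contradiction B~C (V₂-stable B∈ C∈)
    common-neighbour B∈ C∈ (B~x ∷ (x~C ∷ [])) _ = _ , B~x , ~-sym x~C
    -- Both inner vertices would lie in `V₁` and yet be adjacent.
    common-neighbour B∈ C∈ (B~x ∷ (x~D ∷ (D~C ∷ []))) _ =
      contradiction x~D (V₁-stable (crossʳ B∈ B~x) (crossʳ C∈ (~-sym D~C)))
    common-neighbour B∈ C∈ (_ ∷ (_ ∷ (_ ∷ (_ ∷ _)))) (s≤s (s≤s (s≤s ())))

    incident : ∀ {B x} → B ∈ V₂ → B ~ x → inc x B ≡ true
    incident {B} {x} B∈V₂ B~x = trans (incident-to-V₂ B∈V₂ x) (dec-true (B ~? x) B~x)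

    meet : ∀ {B C} → Q B ≡ true → Q C ≡ true → ∃[ x ] inc x B ≡ true × inc x C ≡ true
    meet {B} {C} QB QC
      with B∈V₂ ← lookup⇒[]= B V₂ QB
         | C∈V₂ ← lookup⇒[]= C V₂ QC
         | _ , (walk , _) , k≤3 ← proj₁ hasDiameter B C
      with x , B~x , C~x ← common-neighbour B∈V₂ C∈V₂ walk k≤3
      = x , incident B∈V₂ B~x , incident C∈V₂ C~x

    module Family = RegularIntersectingFamily inc P Q ρ t row col meet

  N₂≡ρN₁ : N₂ G ≡ ρ * N₁ G
  N₂≡ρN₁ = trans (∣p∣≡∑ V₂) (trans Family.blocks≡ρ*points (cong (ρ *_) (sym (∣p∣≡∑ V₁))))

  N₁-bound : .{{NonZero ρ}} → .{{NonZero t}} → N₁ G + t ≤ suc t * suc t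
  N₁-bound = subst (λ N → N + t ≤ suc t * suc t) (sym (∣p∣≡∑ V₁)) Family.points≤s²-s+1

  order≡N₁*[ρ+1] : order G ≡ N₁ G * (ρ + 1)
  order≡N₁*[ρ+1] = begin
    order G             ≡⟨ ∣p∣+∣q∣≡n V₁ V₂ cover disjoint ⟨
    N₁ G + N₂ G         ≡⟨ cong (N₁ G +_) N₂≡ρN₁ ⟩
    N₁ G + ρ * N₁ G     ≡⟨ factor (N₁ G) ρ ⟩
    N₁ G * (ρ + 1)      ∎
    where
    open ≡-Reasoning
    factor : ∀ n ρ → n + ρ * n ≡ n * (ρ + 1)
    factor = solve-∀

-- Evaluation of the Moore bound at multiples of s.

gcd[mn,n]≡n : ∀ m n → gcd (m * n) n ≡ n
gcd[mn,n]≡n m n = ∣-antisym (gcd[m,n]∣n (m * n) n) (gcd-greatest (n∣m*n m) ∣-refl)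

-- 1 + s(ρs − 1) = (s² − 1)ρ + (ρ − t) with s = 1 + t and ρ = 1 + p.
moore-quotient : ∀ t p → 1 ≤ t → t ≤ suc p →
                 (1 + suc t * (t + p * suc t)) / suc p ≡ suc t * suc t ∸ 1
moore-quotient t p 1≤t t≤ρ = begin
  (1 + suc t * (t + p * suc t)) / suc p  ≡⟨ /-congˡ split ⟩
  (d + q * suc p) / suc p                ≡⟨ +-distrib-/-∣ʳ d (n∣m*n q) ⟩
  d / suc p + q * suc p / suc p          ≡⟨ cong₂ _+_ (m<n⇒m/n≡0 d<ρ) (m*n/n≡m q (suc p)) ⟩
  q                                      ∎
  where
  open ≡-Reasoning
  d = suc p ∸ t
  q = suc t * suc t ∸ 1
  t+d≡ρ : t + d ≡ suc p
  t+d≡ρ = m+[n∸m]≡n t≤ρ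
  d<ρ : d < suc p
  d<ρ = ∸-monoʳ-< 1≤t t≤ρ
  -- `q` reduces to `t + t * suc t`, the coefficient of `suc p` on the right; adding `t` to both
  -- sides avoids subtraction.
  expand : ∀ t p → t + (1 + suc t * (t + p * suc t)) ≡ suc p + (t + t * suc t) * suc p
  expand = solve-∀
  split : 1 + suc t * (t + p * suc t) ≡ d + q * suc p
  split = +-cancelˡ-≡ t _ _ (begin
    t + (1 + suc t * (t + p * suc t))  ≡⟨ expand t p ⟩
    suc p + q * suc p                  ≡⟨ cong (_+ q * suc p) t+d≡ρ ⟨
    t + d + q * suc p                  ≡⟨ +-assoc t d _ ⟩
    t + (d + q * suc p)                ∎)

M-multiple : ∀ t ρ → 1 ≤ t → t ≤ ρ → M[ ρ * suc t , suc t ⨾3] ≡ (suc t * suc t ∸ 1) * (ρ + 1)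
-- Here the Moore bound takes its dummy value, but 1 ≤ t ≤ ρ excludes ρ = 0.
M-multiple t zero    1≤t t≤0 = contradiction (≤-trans 1≤t t≤0) λ ()
M-multiple t ρ@(suc p) 1≤t t≤ρ =
  cong₂ _*_ (trans (/-congʳ {{_}} ρ′≡ρ) (moore-quotient t p 1≤t t≤ρ)) (cong₂ _+_ ρ′≡ρ σ′≡1)
  where
  s g : ℕ
  s = suc t
  g = gcd (ρ * s) s
  g≡s : g ≡ s
  g≡s = gcd[mn,n]≡n ρ s
  instance
    g-nonZero : NonZero g
    g-nonZero = subst NonZero (sym g≡s) _
  ρ′≡ρ : ρ * s / g ≡ ρ
  ρ′≡ρ = trans (/-congʳ g≡s) (m*n/n≡m ρ s)
  σ′≡1 : s / g ≡ 1
  σ′≡1 = trans (/-congʳ g≡s) (n/n≡1 s)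

-- The improved bound and its case of equality.

proposition1p3 : ∀ (s ρ : ℕ) → 3 ≤ s → s ∸ 1 ≤ ρ → ρ ≤ s ^ 2 ∸ s ∸ 3 →
    M[ ρ * s , s ⨾3] ≡ (s ^ 2 ∸ 1) * (ρ + 1)
    × ¬ (Σ[ G ∈ [ ρ * s , s ⨾ 3 ]-Bigraph ] order G ≡ M[ ρ * s , s ⨾3])
    × (∀ (G : [ ρ * s , s ⨾ 3 ]-Bigraph) →
    order G ≤ (s ^ 2 ∸ 2) * (ρ + 1)
    × (order G ≡ (s ^ 2 ∸ 2) * (ρ + 1) ⇔ (N₁ G ≡ s ^ 2 ∸ 2 × N₂ G ≡ ρ * (s ^ 2 ∸ 2))))
-- `s ^ 2` unfolds to `s * suc (t * 1)`; the rewrite makes it `s * s`.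
proposition1p3 (suc t) ρ (s≤s 2≤t) t≤ρ _ rewrite *-identityʳ t =
  M≡ , (λ (G , order≡M) → <⇒≢ (≤-<-trans (order≤ G) bound<M) (trans order≡M M≡)) ,
  λ G → order≤ G , mk⇔ (to G) (from G)
  where
  s = suc t
  1≤t = ≤-trans (s≤s z≤n) 2≤t
  instance
    t-nonZero : NonZero t
    t-nonZero = >-nonZero 1≤t
    ρ-nonZero : NonZero ρ
    ρ-nonZero = >-nonZero (≤-trans 1≤t t≤ρ)
    ρ+1-nonZero : NonZero (ρ + 1)
    ρ+1-nonZero = >-nonZero (m≤n+m 1 ρ)

  M≡ : M[ ρ * s , s ⨾3] ≡ (s * s ∸ 1) * (ρ + 1)
  M≡ = M-multiple t ρ 1≤t t≤ρ

  bound<M : (s * s ∸ 2) * (ρ + 1) < (s * s ∸ 1) * (ρ + 1)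
  -- That s² is at least 2 keeps the truncated subtractions strictly ordered.
  bound<M = *-monoˡ-< (ρ + 1) (∸-monoʳ-< {s * s} (s≤s (s≤s z≤n)) (≤-trans 2≤t (≤-trans (n≤1+n t) (m≤m*n s s))))

  module _ (G : [ ρ * s , s ⨾ 3 ]-Bigraph) where
    open BigraphBound {ρ} {t} G

    N₁≤ : N₁ G ≤ s * s ∸ 2
    -- Here s ≥ 3 enters: t ≥ 2 weakens N₁ + t ≤ s² to N₁ + 2 ≤ s².
    N₁≤ = m+n≤o⇒m≤o∸n (N₁ G) (≤-trans (+-monoʳ-≤ (N₁ G) 2≤t) N₁-bound)

    order≤ : order G ≤ (s * s ∸ 2) * (ρ + 1)
    order≤ = ≤-trans (≤-reflexive order≡N₁*[ρ+1]) (*-monoˡ-≤ (ρ + 1) N₁≤)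

    to : order G ≡ (s * s ∸ 2) * (ρ + 1) → N₁ G ≡ s * s ∸ 2 × N₂ G ≡ ρ * (s * s ∸ 2)
    to order≡ = N₁≡ , trans N₂≡ρN₁ (cong (ρ *_) N₁≡)
      where
      N₁≡ : N₁ G ≡ s * s ∸ 2
      N₁≡ = *-cancelʳ-≡ (N₁ G) (s * s ∸ 2) (ρ + 1) (trans (sym order≡N₁*[ρ+1]) order≡)

    from : N₁ G ≡ s * s ∸ 2 × N₂ G ≡ ρ * (s * s ∸ 2) → order G ≡ (s * s ∸ 2) * (ρ + 1)
    from (N₁≡ , _) = trans order≡N₁*[ρ+1] (cong (_* (ρ + 1)) N₁≡)
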